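{- Let $G$ be an interval graph. Then $o(G)=\mathcal{D}$ if and only if $G$ admits a pairing dominating set.
   Context: All graphs are finite and simple; $N[v]$ denotes the closed neighborhood of $v$. An interval graph is the intersection graph of a family of closed intervals of the real line: each vertex corresponds to an interval, and two vertices are adjacent if and only if their intervals intersect. A pairing dominating set of a graph $G=(V,E)$ is a set of pairs of vertices $\{(u_1,v_1),\dots,(u_k,v_k)\}$ of $V$ such that all the vertices appearing in the pairs are distinct and $V=\bigcup_{i=1}^k \left(N[u_i]\cap N[v_i]\right)$. The Maker-Breaker domination game on a graph $G$: two players, Dominator and Staller, alternately claim a not-yet-claimed vertex of $G$. Dominator wins if at some point the vertices she has claimed form a dominating set of $G$. Otherwise, i.e. if Staller manages to claim a vertex and all its neighbors, Staller wins. The graph $G$ has outcome $\mathcal{D}$, written $o(G)=\mathcal{D}$, if Dominator has a winning strategy whoever starts (equivalently, if Dominator has a winning strategy when playing second, since no player benefits from skipping a turn). -}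

module Defs where

open import Level using (0ℓ)
open import Data.Fin using (Fin)
open import Data.Fin.Subset using (Subset; _∈_; _∉_; _∪_; ⁅_⁆) renaming (⊥ to ∅)
open import Data.List using (List; []; _∷_; concatMap)
open import Data.List.Relation.Unary.Any using (Any)
open import Data.List.Relation.Unary.Unique.Propositional using (Unique)
open import Data.Nat using (ℕ)
open import Data.Product using (Σ; ∃; _×_; _,_)
open import Data.Rational using (ℚ; _<_)
open import Data.Sum using (_⊎_)
open import Function.Bundles using (_⇔_)
open import Relation.Binary using (Rel; Decidable; Symmetric)
open import Relation.Binary.PropositionalEquality using (_≡_; _≢_)
open import Relation.Nullary using (¬_)
open import Relation.Unary using (Pred; Satisfiable; _⊆_)

-- Adjacency is decidable, as it is classically for every finite graph.
record Graph : Set₁ where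
  infix 4 _~_ _~?_
  field
    order    : ℕ
    _~_      : Rel (Fin order) 0ℓ
    _~?_     : Decidable _~_
    ~-sym    : Symmetric _~_
    ~-irrefl : ∀ {v} → ¬ (v ~ v)

  Vertex : Set
  Vertex = Fin order

  N[_] : Vertex → Pred Vertex 0ℓ
  N[ v ] w = w ≡ v ⊎ w ~ v

  Dominating : Subset order → Set
  Dominating D = ∀ w → ∃ λ v → v ∈ D × N[ v ] w

-- The real numbers, as (two-sided, located) Dedekind cuts of ℚ:
-- Lower q means q < x, and Upper q means x < q.
record ℝ : Set₁ where
  field
    Lower Upper     : Pred ℚ 0ℓ
    lower-inhabited : Satisfiable Lower
    upper-inhabited : Satisfiable Upper
    lower-rounded   : ∀ q → Lower q ⇔ (∃ λ r → q < r × Lower r)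
    upper-rounded   : ∀ q → Upper q ⇔ (∃ λ r → r < q × Upper r)
    disjoint        : ∀ q → ¬ (Lower q × Upper q)
    located         : ∀ {q r} → q < r → Lower q ⊎ Upper r

infix 4 _≤ℝ_
_≤ℝ_ : Rel ℝ 0ℓ
x ≤ℝ y = ℝ.Lower x ⊆ ℝ.Lower y

record ClosedInterval : Set₁ where
  field
    left right : ℝ
    left≤right : left ≤ℝ right

  Contains : Pred ℝ 0ℓ
  Contains x = left ≤ℝ x × x ≤ℝ right

Intersect : ClosedInterval → ClosedInterval → Set₁
Intersect I J = Σ ℝ λ x → ClosedInterval.Contains I x × ClosedInterval.Contains J x

record IsIntervalGraph (G : Graph) : Set₁ where
  open Graph G
  field
    interval  : Vertex → ClosedInterval
    -- Restricted to distinct vertices: graphs are loopless, but an interval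
    -- always meets itself. Distinct vertices may have equal intervals.
    adjacent⇔ : ∀ {u v} → u ≢ v → u ~ v ⇔ Intersect (interval u) (interval v)

module _ (G : Graph) where
  open Graph G

  -- Uniqueness of the flattened list u₁, v₁, …, u_k, v_k also forces
  -- uᵢ ≢ vᵢ within each pair.
  record IsPairingDominatingSet (ps : List (Vertex × Vertex)) : Set where
    field
      distinct : Unique (concatMap (λ (u , v) → u ∷ v ∷ []) ps)
      covers   : ∀ w → Any (λ (u , v) → N[ u ] w × N[ v ] w) ps

  HasPairingDominatingSet : Set
  HasPairingDominatingSet = ∃ IsPairingDominatingSet

data Player : Set where
  dominator staller : Player

module _ (G : Graph) where
  open Graph G

  -- WinningStrategy p D S is the type of winning strategies (as finite game
  -- trees) for Dominator from the position in which D and S are the sets of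
  -- vertices claimed by Dominator and Staller and p is to move.
  data WinningStrategy : Player → Subset order → Subset order → Set where
    won           : ∀ {p D S} → Dominating D → WinningStrategy p D S
    dominatorMove : ∀ {D S} v → v ∉ D ∪ S →
                    WinningStrategy staller (D ∪ ⁅ v ⁆) S →
                    WinningStrategy dominator D S
    -- The first argument excludes a full board: there the game is over, and
    -- Dominator has lost unless D is dominating.
    stallerMove   : ∀ {D S} → (∃ λ v → v ∉ D ∪ S) →
                    (∀ v → v ∉ D ∪ S → WinningStrategy dominator D (S ∪ ⁅ v ⁆)) →
                    WinningStrategy staller D S

  Outcome𝓓 : Set
  Outcome𝓓 = ∀ starter → WinningStrategy starter ∅ ∅

{-# OPTIONS --safe #-}

-- (⇒) An interval graph has a model with integer endpoints l, r. By induction on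
-- the winning strategy, every free vertex x has a reply y such that some pairing
-- M x of the free vertices other than x and y takes care of all undominated
-- vertices outside N[y]. If the interval of y lies inside that of x, adding the
-- pair (x , y) to M x finishes. Otherwise y sticks out of x on the right or on
-- the left. Moving from a vertex a to the vertex b with least l b among those
-- with r a < r b, starting with the leftmost vertex, one meets a and b such that
-- the reply to a sticks out on the right and the reply to b on the left. Then
-- (a , b), the pairs of M a starting before b and the pairs of M b ending after a
-- are disjoint, since no free interval both starts before b and ends after a, and
-- together they cover everything.
-- (⇐) Whenever Staller claims a vertex of a pair, Dominator claims its partner.
module Submission where

open import Defs
open import Level using (Level; 0ℓ)
open import Data.Empty using (⊥-elim)
open import Data.Fin using (Fin; zero; suc; toℕ; fromℕ<; finToFun; funToFin; _≤_; _<_; _>_)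
open import Data.Fin.Induction using (>-wellFounded)
open import Data.Fin.Properties
  using (_≟_; _≤?_; _<?_; any?; all?; ∀-cons; toℕ-fromℕ<; finToFun-funToFin)
open import Data.Fin.Subset using (Subset; _∈_; _∉_; _∪_; ⁅_⁆; ∣_∣) renaming (⊥ to ∅)
open import Data.Fin.Subset.Properties
  using (_∈?_; ∉⊥; ∣p∣≤n; p⊆q⇒∣p∣≤∣q∣; p⊂q⇒∣p∣<∣q∣; p⊆p∪q; x∈p∪q⁻; x∈p∪q⁺; x∈⁅x⁆; x∈⁅y⁆⇒x≡y)
open import Data.List using (List; []; _∷_; _++_; concatMap; filter; length; allFin)
open import Data.List.Extrema.Nat using (argmin; argmin-all; f[argmin]≤f[xs])
open import Data.List.Membership.Propositional.Properties using (∈-filter⁺; ∈-allFin)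
open import Data.List.Relation.Binary.Permutation.Propositional
  using (_↭_; refl; prep; swap; trans; ↭⇒↭ₛ)
open import Data.List.Relation.Binary.Permutation.Propositional.Properties
  using (All-resp-↭; Any-resp-↭; ↭-length)
import Data.List.Relation.Binary.Permutation.Setoid.Properties as Permutation
open import Data.List.Relation.Unary.All as All using (All; []; _∷_)
import Data.List.Relation.Unary.All.Properties as All
open import Data.List.Relation.Unary.AllPairs as AllPairs using (AllPairs; []; _∷_)
import Data.List.Relation.Unary.AllPairs.Properties as AllPairs
open import Data.List.Relation.Unary.Any as Any using (Any; here; there)
import Data.List.Relation.Unary.Any.Properties as Any
open import Data.List.Relation.Unary.Unique.Propositional using (Unique)
open import Data.Nat as ℕ using (ℕ; zero; suc; s≤s)
import Data.Nat.Properties as ℕ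
open import Data.Product using (∃; ∃₂; _×_; _,_; proj₁; proj₂)
import Data.Rational.Properties as ℚ
open import Data.Sum as Sum using (_⊎_; inj₁; inj₂; [_,_]′)
open import Data.Vec using (tabulate)
open import Data.Vec.Properties using (lookup∘tabulate; lookup⇒[]=; []=⇒lookup)
open import Function using (id; _∘_; case_of_)
open import Function.Bundles using (_⇔_; mk⇔; Equivalence)
open import Induction.WellFounded using (Acc; acc)
open import Relation.Binary.Definitions using (Symmetric; tri<; tri≈; tri>)
open import Relation.Binary.PropositionalEquality as ≡ using (_≡_; _≢_; refl; sym)
open import Relation.Nullary
  using (¬_; Dec; yes; no; does; ¬?; contradiction; _×-dec_; _⊎-dec_; _→-dec_)
open import Relation.Nullary.Decidable
  using (decidable-stable; map′; dec-true; dec-false; ¬¬-excluded-middle)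
open import Relation.Unary using (Pred; Decidable)

-- Double negation, subsets and minima over finite types

private
  variable
    a : Level
    A : Set a
    n : ℕ

-- Used to assume all the finitely many endpoint comparisons decided at once under a double
-- negation.
¬¬-∀ : {P : Fin n → Set a} → (∀ i → ¬ ¬ P i) → ¬ ¬ (∀ i → P i)
¬¬-∀ {zero}  h k = k λ ()
¬¬-∀ {suc n} h k = h zero λ p → ¬¬-∀ (h ∘ suc) λ ps → k (∀-cons p ps)

module _ {P : Pred (Fin n) 0ℓ} (P? : Decidable P) where

  subset : Subset n
  subset = tabulate (does ∘ P?)

  ∈-subset⁺ : ∀ {i} → P i → i ∈ subset
  ∈-subset⁺ {i} p =
    lookup⇒[]= i subset (≡.trans (lookup∘tabulate (does ∘ P?) i) (dec-true (P? i) p))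

  ∈-subset⁻ : ∀ {i} → i ∈ subset → P i
  ∈-subset⁻ {i} i∈ = decidable-stable (P? i) λ ¬p →
    case ≡.trans (sym (dec-false (P? i) ¬p))
           (≡.trans (sym (lookup∘tabulate (does ∘ P?) i)) ([]=⇒lookup i∈)) of λ ()

  least : (f : Fin n → ℕ) → ∃ P → ∃ λ m → P m × (∀ z → P z → f m ℕ.≤ f z)
  -- The default `z₀` of `argmin` satisfies `P` itself, so the minimiser does whichever entry is
  -- selected.
  least f (z₀ , p₀) = argmin f z₀ zs , argmin-all f p₀ (All.all-filter P? (allFin n)) ,
    λ z p → All.lookup (f[argmin]≤f[xs] {f = f} z₀ zs) (∈-filter⁺ P? (∈-allFin z) p)
    where zs = filter P? (allFin n)

Any-filter⁺ : {P Q : Pred A 0ℓ} (Q? : Decidable Q) → (∀ {x} → P x → Q x) →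
              ∀ {xs} → Any P xs → Any P (filter Q? xs)
Any-filter⁺ Q? P⇒Q any =
  [ id , (λ ¬q → contradiction (P⇒Q (Any.lookup-result any)) ¬q) ]′ (Any.filter⁺ Q? any)

-- Dedekind reals

-- For `q` below `y`, roundedness gives `r` with `q < r` still below `y`, and `x` is located at
-- `q < r`. Were `x` below `r`, then `r` would separate `x` from `y` and force `x ≤ℝ y`.
≤ℝ-connex : ∀ {x y} → ¬ x ≤ℝ y → y ≤ℝ x
≤ℝ-connex {x} {y} x≰y {q} q<y with Equivalence.to (ℝ.lower-rounded y q) q<y
... | r , q<r , r<y with ℝ.located x q<r
...   | inj₁ q<x = q<x
...   | inj₂ x<r = ⊥-elim (x≰y x≤y)
  where
  x≤y : x ≤ℝ y
  x≤y {s} s<x with ℚ.<-cmp s r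
  ... | tri< s<r _ _ = Equivalence.from (ℝ.lower-rounded y s) (r , s<r , r<y)
  ... | tri≈ _ refl _ = r<y
  ... | tri> _ _ r<s =
    contradiction (Equivalence.from (ℝ.lower-rounded x r) (s , r<s , s<x) , x<r) (ℝ.disjoint x r)

module _ (f : Fin n → ℝ) where

  Decides : ℝ → Set
  Decides x = ∀ i → Dec (x ≤ℝ f i)

  -- Counting the values of `f` strictly below `x` turns a real into a natural number while keeping
  -- its comparison with each `f i`.
  rank : ∀ x → Decides x → ℕ
  rank x x≤? = ∣ subset (¬? ∘ x≤?) ∣

  rank-mono : ∀ {x y} (x≤? : Decides x) (y≤? : Decides y) → x ≤ℝ y →
              rank x x≤? ℕ.≤ rank y y≤?
  rank-mono {x} {y} x≤? y≤? x≤y = p⊆q⇒∣p∣≤∣q∣ λ {i} i∈ →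
    ∈-subset⁺ (¬? ∘ y≤?) λ (y≤fi : y ≤ℝ f i) →
      ∈-subset⁻ (¬? ∘ x≤?) i∈ λ {q} q<x → y≤fi {q} (x≤y {q} q<x)

  -- The index `i` is counted for `y` but not for `f i`. Any `j` counted for `f i` is counted for
  -- `y`, since `f j ≤ℝ f i` by `≤ℝ-connex`.
  rank-strict : ∀ i {y} (fi≤? : Decides (f i)) (y≤? : Decides y) →
                ¬ y ≤ℝ f i → rank (f i) fi≤? ℕ.< rank y y≤?
  rank-strict i {y} fi≤? y≤? y≰fi = p⊂q⇒∣p∣<∣q∣
    ( (λ {j} j∈ → ∈-subset⁺ (¬? ∘ y≤?) λ (y≤fj : y ≤ℝ f j) →
        y≰fi λ {q} q<y → ≤ℝ-connex {f i} {f j} (∈-subset⁻ (¬? ∘ fi≤?) j∈) {q} (y≤fj {q} q<y))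
    , i , ∈-subset⁺ (¬? ∘ y≤?) y≰fi
    , λ i∈ → ∈-subset⁻ (¬? ∘ fi≤?) i∈ id )

-- Integer endpoints of interval graphs

module _ (G : Graph) where
  open Graph G

  Meets : ∀ {k} (l r : Vertex → Fin k) → Vertex → Vertex → Set
  Meets l r v w = l v ≤ r w × l w ≤ r v

  -- With closed neighbourhoods, the diagonal case encodes `l v ≤ r v`.
  IsModel : ∀ {k} (l r : Vertex → Fin k) → Set
  IsModel l r = ∀ v w → (N[ v ] w → Meets l r v w) × (Meets l r v w → N[ v ] w)

  isModel? : ∀ {k} (l r : Vertex → Fin k) → Dec (IsModel l r)
  isModel? l r = all? λ v → all? λ w → (N? v w →-dec M? v w) ×-dec (M? v w →-dec N? v w)
    where
    N? : ∀ v w → Dec (N[ v ] w)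
    N? v w = (w ≟ v) ⊎-dec (w ~? v)
    M? : ∀ v w → Dec (Meets l r v w)
    M? v w = (l v ≤? r w) ×-dec (l w ≤? r v)

  -- The search runs over codes of endpoint functions, and decoding a code recovers the function
  -- only pointwise.
  IsModel-≗ : ∀ {k} {l r l′ r′ : Vertex → Fin k} →
              (∀ v → l′ v ≡ l v) → (∀ v → r′ v ≡ r v) → IsModel l r → IsModel l′ r′
  IsModel-≗ {l = l} {r} {l′} {r′} l′≗l r′≗r model v w
    rewrite l′≗l v | l′≗l w | r′≗r v | r′≗r w = model v w

  -- The order of real endpoints is undecidable, but a model with endpoints in a
  -- fixed finite set can be searched for, so its double negation suffices.
  model-stable : ∀ {k} → ¬ ¬ (∃₂ λ (l r : Vertex → Fin k) → IsModel l r) →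
                 ∃₂ λ (l r : Vertex → Fin k) → IsModel l r
  model-stable ¬¬model =
    let i , j , model = decidable-stable
          (any? λ i → any? λ j → isModel? (finToFun i) (finToFun j))
          λ ¬search → ¬¬model λ (l , r , model) → ¬search
            ( funToFin l , funToFin r
            , IsModel-≗ (finToFun-funToFin l) (finToFun-funToFin r) model )
    in finToFun i , finToFun j , model

  module _ (isInterval : IsIntervalGraph G) where
    open IsIntervalGraph isInterval

    L R : Vertex → ℝ
    L v = ClosedInterval.left (interval v)
    R v = ClosedInterval.right (interval v)

    L≤R : ∀ v → L v ≤ℝ R v
    L≤R v = ClosedInterval.left≤right (interval v)

    N⇒L≤R : ∀ v w → N[ v ] w → L v ≤ℝ R w
    N⇒L≤R v .v (inj₁ refl) = L≤R v
    N⇒L≤R v w (inj₂ w~v) with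
      Equivalence.to (adjacent⇔ {w} {v} λ { refl → ~-irrefl w~v }) w~v
    ... | x , (_ , x≤Rw) , (Lv≤x , _) = λ q<Lv → x≤Rw (Lv≤x q<Lv)

    N-sym : ∀ v w → N[ v ] w → N[ w ] v
    N-sym v w = Sum.map sym ~-sym

    -- The larger of the two left endpoints is a common point; the decision tells which one it is.
    L≤R⇒N : ∀ v w → Dec (L v ≤ℝ L w) → L v ≤ℝ R w → L w ≤ℝ R v → N[ v ] w
    L≤R⇒N v w d Lv≤Rw Lw≤Rv with w ≟ v
    ... | yes w≡v = inj₁ w≡v
    ... | no w≢v = inj₂ (Equivalence.from (adjacent⇔ w≢v) (common d))
      where
      common : Dec (L v ≤ℝ L w) → Intersect (interval w) (interval v)
      common (yes Lv≤Lw) = L w , (id , L≤R w) , (Lv≤Lw , Lw≤Rv)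
      common (no  Lv≰Lw) = L v , (≤ℝ-connex {L v} {L w} Lv≰Lw , Lv≤Rw) , (id , L≤R v)

    module _ (LL? : ∀ v w → Dec (L v ≤ℝ L w)) (LR? : ∀ v w → Dec (L v ≤ℝ R w))
             (RR? : ∀ v w → Dec (R v ≤ℝ R w)) where

      -- Both kinds of endpoint are ranked among the right endpoints, which suffices because
      -- intersection only compares left with right. Ranks run from 0 to `order`, hence `suc order`.
      l r : Vertex → Fin (suc order)
      l v = fromℕ< (s≤s (∣p∣≤n (subset (¬? ∘ LR? v))))
      r v = fromℕ< (s≤s (∣p∣≤n (subset (¬? ∘ RR? v))))

      l≤r⁺ : ∀ v w → L v ≤ℝ R w → l v ≤ r w
      l≤r⁺ v w Lv≤Rw = ≡.subst₂ ℕ._≤_ (sym (toℕ-fromℕ< _)) (sym (toℕ-fromℕ< _))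
        (rank-mono R {L v} {R w} (LR? v) (RR? w) Lv≤Rw)

      l≤r⁻ : ∀ v w → l v ≤ r w → L v ≤ℝ R w
      l≤r⁻ v w lv≤rw = decidable-stable (LR? v w) λ Lv≰Rw →
        ℕ.<⇒≱ (rank-strict R w {L v} (RR? w) (LR? v) Lv≰Rw)
          (≡.subst₂ ℕ._≤_ (toℕ-fromℕ< _) (toℕ-fromℕ< _) lv≤rw)

      rank-model : IsModel l r
      rank-model v w =
        (λ vw → l≤r⁺ v w (N⇒L≤R v w vw) , l≤r⁺ w v (N⇒L≤R w v (N-sym v w vw))) ,
        (λ (lv≤rw , lw≤rv) → L≤R⇒N v w (LL? v w) (l≤r⁻ v w lv≤rw) (l≤r⁻ w v lw≤rv))

    integer-model : ∃₂ λ (l r : Vertex → Fin (suc order)) → IsModel l r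
    integer-model = model-stable λ ¬model →
      dec L L λ LL? → dec L R λ LR? → dec R R λ RR? →
      ¬model (l LL? LR? RR? , r LL? LR? RR? , rank-model LL? LR? RR?)
      where
      dec : (f g : Vertex → ℝ) → ¬ ¬ (∀ v w → Dec (f v ≤ℝ g w))
      dec f g = ¬¬-∀ λ v → ¬¬-∀ λ w → ¬¬-excluded-middle

-- Pairings

  Pair : Set
  Pair = Vertex × Vertex

  record Both (P : Pred Vertex 0ℓ) (p : Pair) : Set where
    constructor both
    field
      first  : P (proj₁ p)
      second : P (proj₂ p)
  open Both

  Both? : ∀ {P} → Decidable P → Decidable (Both P)
  Both? P? (u , v) = map′ (λ (p , q) → both p q) (λ (both p q) → p , q) (P? u ×-dec P? v)

  Both-map : ∀ {P Q : Pred Vertex 0ℓ} → (∀ {v} → P v → Q v) → ∀ {p} → Both P p → Both Q p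
  Both-map f (both p q) = both (f p) (f q)

  Both-zip : ∀ {P Q R : Pred Vertex 0ℓ} → (∀ {v} → P v → Q v → R v) →
             ∀ {p} → Both P p × Both Q p → Both R p
  Both-zip f (both p q , both p′ q′) = both (f p p′) (f q q′)

  Both-either : ∀ {P : Pred Vertex 0ℓ} {u v y} → Both P (u , v) → y ≡ u ⊎ y ≡ v → P y
  Both-either (both p _) (inj₁ refl) = p
  Both-either (both _ p) (inj₂ refl) = p

  Apart : Pair → Pair → Set
  Apart p q = Both (λ u → Both (u ≢_) q) p

  Apart-sym : Symmetric Apart
  Apart-sym (both (both ux uy) (both vx vy)) =
    both (both (ux ∘ sym) (vx ∘ sym)) (both (uy ∘ sym) (vy ∘ sym))

  Apart⁺ : ∀ {P Q : Pred Vertex 0ℓ} → (∀ {v} → P v → ¬ Q v) →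
           ∀ {p q} → Both P p → Both Q q → Apart p q
  Apart⁺ disjoint Pp Qq = Both-map (λ Pu → Both-map (λ { Qv refl → disjoint Pu Qv }) Qq) Pp

  -- Uniqueness of the flattened list, split by pairs so that it passes to filtered, concatenated
  -- and permuted lists of pairs.
  Matching : Pred (List Pair) 0ℓ
  Matching ps = All (λ (u , v) → u ≢ v) ps × AllPairs Apart ps

  Covers : Vertex → Pred Pair 0ℓ
  Covers w = Both λ v → N[ v ] w

  -- A pairing dominating set relative to a game position: `Free` stands for unclaimed, `Done` for
  -- already dominated.
  record IsPairing (Free Done : Pred Vertex 0ℓ) (ps : List Pair) : Set where
    field
      matching : Matching ps
      free     : All (Both Free) ps
      covers   : ∀ w → Done w ⊎ Any (Covers w) ps

  Pairing : (Free Done : Pred Vertex 0ℓ) → Set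
  Pairing Free Done = ∃ (IsPairing Free Done)

  trivialPairing : ∀ {Free Done} → (∀ w → Done w) → Pairing Free Done
  trivialPairing done = [] , record { matching = [] , [] ; free = [] ; covers = inj₁ ∘ done }

  Pairing-map : ∀ {Free Free′ Done Done′ : Pred Vertex 0ℓ} →
                (∀ {v} → Free v → Free′ v) → (∀ {w} → Done w → Done′ w) →
                Pairing Free Done → Pairing Free′ Done′
  Pairing-map f g (ps , pairing) = ps , record
    { matching = matching
    ; free     = All.map (Both-map f) free
    ; covers   = Sum.map₁ g ∘ covers
    } where open IsPairing pairing

  flat : List Pair → List Vertex
  flat = concatMap λ (u , v) → u ∷ v ∷ []

  All-flat⁺ : ∀ {P : Pred Vertex 0ℓ} {ps} → All (Both P) ps → All P (flat ps)
  All-flat⁺ []             = []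
  All-flat⁺ (both p q ∷ ps) = p ∷ q ∷ All-flat⁺ ps

  All-flat⁻ : ∀ {P : Pred Vertex 0ℓ} {ps} → All P (flat ps) → All (Both P) ps
  All-flat⁻ {ps = []}    []           = []
  All-flat⁻ {ps = _ ∷ _} (p ∷ q ∷ ps) = both p q ∷ All-flat⁻ ps

  Matching⇒Unique : ∀ {ps} → Matching ps → Unique (flat ps)
  Matching⇒Unique ([] , [])                   = []
  Matching⇒Unique (u≢v ∷ distinct , ap ∷ aps) =
    (u≢v ∷ All-flat⁺ (All.map first ap)) ∷ All-flat⁺ (All.map second ap) ∷
    Matching⇒Unique (distinct , aps)

  Unique⇒Matching : ∀ {ps} → Unique (flat ps) → Matching ps
  Unique⇒Matching {[]}    []                           = [] , []
  Unique⇒Matching {_ ∷ _} ((u≢v ∷ u∉) ∷ v∉ ∷ unique) =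
    let distinct , aps = Unique⇒Matching unique
    in u≢v ∷ distinct ,
       All.zipWith (λ (u∉p , v∉p) → both u∉p v∉p) (All-flat⁻ u∉ , All-flat⁻ v∉) ∷ aps

-- The pairing strategy

  DominatedBy : Subset order → Pred Vertex 0ℓ
  DominatedBy D w = ∃ λ v → v ∈ D × N[ v ] w

  DominatedBy-∪ˡ : ∀ {D} E {w} → DominatedBy D w → DominatedBy (D ∪ E) w
  DominatedBy-∪ˡ E (v , v∈D , vw) = v , p⊆p∪q E v∈D , vw

  DominatedBy-⁅⁆ : ∀ D {y w} → N[ y ] w → DominatedBy (D ∪ ⁅ y ⁆) w
  DominatedBy-⁅⁆ D {y} yw = y , x∈p∪q⁺ {p = D} (inj₂ (x∈⁅x⁆ y)) , yw

  DominatedBy-∪⁅⁆⁻ : ∀ D {y w} → DominatedBy (D ∪ ⁅ y ⁆) w → DominatedBy D w ⊎ N[ y ] w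
  DominatedBy-∪⁅⁆⁻ D {y} (v , v∈ , vw) with x∈p∪q⁻ D ⁅ y ⁆ v∈
  ... | inj₁ v∈D = inj₁ (v , v∈D , vw)
  ... | inj₂ v∈y rewrite x∈⁅y⁆⇒x≡y y v∈y = inj₂ vw

  free-staller⁺ : ∀ (D S : Subset order) {v x} → v ∉ D ∪ S → x ≢ v → v ∉ D ∪ (S ∪ ⁅ x ⁆)
  free-staller⁺ D S {v} {x} v∉ x≢v v∈ with x∈p∪q⁻ D (S ∪ ⁅ x ⁆) v∈
  ... | inj₁ v∈D = v∉ (x∈p∪q⁺ (inj₁ v∈D))
  ... | inj₂ v∈Sx with x∈p∪q⁻ S ⁅ x ⁆ v∈Sx
  ...   | inj₁ v∈S = v∉ (x∈p∪q⁺ {p = D} (inj₂ v∈S))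
  ...   | inj₂ v∈x = x≢v (sym (x∈⁅y⁆⇒x≡y x v∈x))

  free-dominator⁺ : ∀ (D S : Subset order) {v y} → v ∉ D ∪ S → y ≢ v → v ∉ (D ∪ ⁅ y ⁆) ∪ S
  free-dominator⁺ D S {v} {y} v∉ y≢v v∈ with x∈p∪q⁻ (D ∪ ⁅ y ⁆) S v∈
  ... | inj₂ v∈S = v∉ (x∈p∪q⁺ {p = D} (inj₂ v∈S))
  ... | inj₁ v∈Dy with x∈p∪q⁻ D ⁅ y ⁆ v∈Dy
  ...   | inj₁ v∈D = v∉ (x∈p∪q⁺ (inj₁ v∈D))
  ...   | inj₂ v∈y = y≢v (sym (x∈⁅y⁆⇒x≡y y v∈y))

  free-staller⁻ : ∀ (D S : Subset order) {v x} → v ∉ D ∪ (S ∪ ⁅ x ⁆) → v ∉ D ∪ S × x ≢ v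
  free-staller⁻ D S {v} v∉ =
    (λ v∈ → v∉ (x∈p∪q⁺ (Sum.map₂ (p⊆p∪q _) (x∈p∪q⁻ D S v∈)))) ,
    λ { refl → v∉ (x∈p∪q⁺ {p = D} (inj₂ (x∈p∪q⁺ {p = S} (inj₂ (x∈⁅x⁆ v))))) }

  free-dominator⁻ : ∀ (D S : Subset order) {v y} → v ∉ (D ∪ ⁅ y ⁆) ∪ S → v ∉ D ∪ S × y ≢ v
  free-dominator⁻ D S {v} v∉ =
    (λ v∈ → v∉ (x∈p∪q⁺ (Sum.map₁ (p⊆p∪q _) (x∈p∪q⁻ D S v∈)))) ,
    λ { refl → v∉ (x∈p∪q⁺ {p = D ∪ ⁅ v ⁆} (inj₁ (x∈p∪q⁺ {p = D} (inj₂ (x∈⁅x⁆ v))))) }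

  PositionPairing : (D S : Subset order) → Pred (List Pair) 0ℓ
  PositionPairing D S = IsPairing (_∉ D ∪ S) (DominatedBy D)

  -- Here `q` is the pair containing `x` if there is one. Otherwise the recursion ends at the last
  -- pair, and any pair would do, since Dominator may then claim a vertex of it for free.
  extract : ∀ x {ps} p → AllPairs Apart (p ∷ ps) →
            ∃₂ λ q rest → p ∷ ps ↭ q ∷ rest × All (Both (x ≢_)) rest
  extract x {ps} (u , v) (ap ∷ aps) with u ≟ x | v ≟ x
  ... | yes refl | _        = _ , _ , refl , All.map first ap
  ... | no _     | yes refl = _ , _ , refl , All.map second ap
  ... | no u≢x   | no v≢x with ps
  ...   | []      = _ , _ , refl , []
  ...   | p′ ∷ ps′ =
    let q , rest , eq , x∉rest = extract x p′ aps
    in q , (u , v) ∷ rest , trans (prep (u , v) eq) (swap (u , v) q refl) ,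
       both (u≢x ∘ sym) (v≢x ∘ sym) ∷ x∉rest

  IsPairing-resp-↭ : ∀ {Free Done ps qs} → ps ↭ qs → IsPairing Free Done ps → IsPairing Free Done qs
  IsPairing-resp-↭ eq pairing = record
    { matching = All-resp-↭ eq (proj₁ matching)
               , Permutation.AllPairs-resp-↭ (≡.setoid Pair) Apart-sym
                   ((λ { refl → id }) , λ { refl → id }) (↭⇒↭ₛ eq) (proj₂ matching)
    ; free     = All-resp-↭ eq free
    ; covers   = Sum.map₂ (Any-resp-↭ eq) ∘ covers
    } where open IsPairing pairing

  dominator-claims : ∀ {D S u v y ps} → PositionPairing D S ((u , v) ∷ ps) → y ≡ u ⊎ y ≡ v →
                     PositionPairing (D ∪ ⁅ y ⁆) S ps
  dominator-claims {D} {S} {u} {v} {y} {ps} pairing y∈ = record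
    { matching = All.tail (proj₁ matching) , AllPairs.tail (proj₂ matching)
    ; free     = All.zipWith (Both-zip (free-dominator⁺ D S))
                   (All.tail free , All.map (λ ap → Both-either ap y∈) (AllPairs.head (proj₂ matching)))
    ; covers   = λ w → covered w (covers w)
    }
    where
    open IsPairing pairing
    covered : ∀ w → DominatedBy D w ⊎ Any (Covers w) ((u , v) ∷ ps) →
              DominatedBy (D ∪ ⁅ y ⁆) w ⊎ Any (Covers w) ps
    covered w (inj₁ d)           = inj₁ (DominatedBy-∪ˡ _ d)
    covered w (inj₂ (here c))    = inj₁ (DominatedBy-⁅⁆ D (Both-either c y∈))
    covered w (inj₂ (there any)) = inj₂ any

  pairing⇒dominating : ∀ {D S} → PositionPairing D S [] → Dominating D
  pairing⇒dominating pairing w with IsPairing.covers pairing w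
  ... | inj₁ d = d

  partner : ∀ x {u v : Vertex} → u ≢ v → ∃ λ y → (y ≡ u ⊎ y ≡ v) × x ≢ y
  partner x {u} {v} u≢v with x ≟ u
  ... | yes refl = v , inj₂ refl , u≢v
  ... | no x≢u   = u , inj₁ refl , x≢u

  -- Each round uses up one pair. The induction is on the number of pairs because `extract` permutes
  -- the list.
  pairing⇒strategy : ∀ k ps {D S} → length ps ≡ k → PositionPairing D S ps →
                     WinningStrategy G staller D S
  pairing⇒strategy zero    []       _  pairing = won (pairing⇒dominating pairing)
  pairing⇒strategy (suc k) (p ∷ ps) {D} {S} len pairing =
    stallerMove (_ , first (All.head (IsPairing.free pairing))) respond
    where
    respond : ∀ x → x ∉ D ∪ S → WinningStrategy G dominator D (S ∪ ⁅ x ⁆)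
    respond x x∉ =
      let q , rest , eq , x∉rest = extract x p (proj₂ (IsPairing.matching pairing))
          pairing′ = IsPairing-resp-↭ eq pairing
          open IsPairing pairing′
          y , y∈q , x≢y = partner x (All.head (proj₁ matching))
          y∉ = Both-either (All.head free) y∈q
          after = dominator-claims pairing′ y∈q
      in dominatorMove y (free-staller⁺ D S y∉ x≢y)
           (pairing⇒strategy k rest (ℕ.suc-injective (≡.trans (sym (↭-length eq)) len)) record
             { matching = IsPairing.matching after
             ; free     = All.zipWith (Both-zip (free-staller⁺ (D ∪ ⁅ y ⁆) S))
                 (IsPairing.free after , x∉rest)
             ; covers   = IsPairing.covers after
             })

  pairing⇒outcome : HasPairingDominatingSet G → Outcome𝓓 G
  pairing⇒outcome (ps , isPairing) = λ
    { staller   → pairing⇒strategy _ ps refl pairing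
    ; dominator → start ps pairing }
    where
    open IsPairingDominatingSet isPairing
    pairing : PositionPairing ∅ ∅ ps
    pairing = record
      { matching = Unique⇒Matching distinct
      ; free     = All.universal (λ _ → both unclaimed unclaimed) ps
      ; covers   = inj₂ ∘ Any.map (λ (uw , vw) → both uw vw) ∘ covers
      }
      where
      unclaimed : ∀ {v : Vertex} → v ∉ ∅ ∪ ∅
      unclaimed = [ ∉⊥ , ∉⊥ ]′ ∘ x∈p∪q⁻ ∅ ∅
    start : ∀ ps → PositionPairing ∅ ∅ ps → WinningStrategy G dominator ∅ ∅
    start []       pairing = won (pairing⇒dominating pairing)
    -- Moving first, Dominator claims one end of a pair and then plays second with the others.
    start (p ∷ ps) pairing = dominatorMove _ (first (All.head (IsPairing.free pairing)))
      (pairing⇒strategy _ ps refl (dominator-claims pairing (inj₁ refl)))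

-- From strategies to pairings

  -- What the induction hypothesis yields once Staller has claimed `x` and Dominator has answered
  -- `y`.
  Reply : (Free Done : Pred Vertex 0ℓ) → Vertex → Vertex → Set
  Reply Free Done x y =
    Free y × x ≢ y × Pairing (λ v → Free v × x ≢ v × y ≢ v) (λ w → Done w ⊎ N[ y ] w)

  -- Combining replies in an interval model

  module _ {k} {l r : Vertex → Fin k} (model : IsModel l r)
           {Free Done : Pred Vertex 0ℓ} (Free? : Decidable Free)
           (reply : ∀ x → Free x → Pairing Free Done ⊎ ∃ (Reply Free Done x)) where

    N⇒Meets : ∀ {v w} → N[ v ] w → Meets l r v w
    N⇒Meets = proj₁ (model _ _)

    Meets⇒N : ∀ {v w} → Meets l r v w → N[ v ] w
    Meets⇒N = proj₂ (model _ _)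

    -- Containment of intervals gives `N[ y ]` inside `N[ x ]`, so the pair `(x , y)` covers all
    -- that `y` would dominate.
    nested : ∀ {x y} → Free x → Reply Free Done x y → l x ≤ l y → r y ≤ r x → Pairing Free Done
    nested {x} {y} fx (fy , x≢y , ps , pairing) lx≤ly ry≤rx = (x , y) ∷ ps , record
      { matching = x≢y ∷ proj₁ matching
                 , All.map (λ p → both (Both-map (proj₁ ∘ proj₂) p) (Both-map (proj₂ ∘ proj₂) p)) free
                   ∷ proj₂ matching
      ; free     = both fx fy ∷ All.map (Both-map proj₁) free
      ; covers   = covered ∘ covers
      }
      where
      open IsPairing pairing
      covered : ∀ {w} → (Done w ⊎ N[ y ] w) ⊎ Any (Covers w) ps → Done w ⊎ Any (Covers w) ((x , y) ∷ ps)
      covered (inj₁ (inj₁ d))  = inj₁ d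
      covered (inj₁ (inj₂ yw)) = let ly≤rw , lw≤ry = N⇒Meets yw in
        inj₂ (here (both (Meets⇒N (ℕ.≤-trans lx≤ly ly≤rw , ℕ.≤-trans lw≤ry ry≤rx)) yw))
      covered (inj₂ any)       = inj₂ (there any)

    RightReply LeftReply : Vertex → Set
    RightReply x = ∃ λ y → r x < r y × Reply Free Done x y
    LeftReply  x = ∃ λ y → l y < l x × Reply Free Done x y

    classify : ∀ {x} → Free x → Pairing Free Done ⊎ RightReply x ⊎ LeftReply x
    classify {x} fx with reply x fx
    ... | inj₁ pairing = inj₁ pairing
    ... | inj₂ (y , rep) with r x <? r y | l y <? l x
    ...   | yes rx<ry | _         = inj₂ (inj₁ (y , rx<ry , rep))
    ...   | no _      | yes ly<lx = inj₂ (inj₂ (y , ly<lx , rep))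
    ...   | no rx≮ry  | no ly≮lx  = inj₁ (nested fx rep (ℕ.≮⇒≥ ly≮lx) (ℕ.≮⇒≥ rx≮ry))

    -- The hypothesis `between` separates the two families of pairs. It also puts `y` entirely at or
    -- after the start of `b`, and makes `y′` end no later than `a`.
    merge : ∀ {a b} → Free a → Free b → l a ≤ l b → r a < r b →
            (∀ z → Free z → r a < r z → l b ≤ l z) →
            RightReply a → LeftReply b → Pairing Free Done
    merge {a} {b} fa fb la≤lb ra<rb between
          (y , ra<ry , fy , _ , ps , pairingᵃ) (y′ , ly′<lb , fy′ , _ , qs , pairingᵇ) =
      (a , b) ∷ as ++ bs , record
        { matching = a≢b ∷ All.++⁺ (All.filter⁺ left? (proj₁ A.matching))
                                   (All.filter⁺ right? (proj₁ B.matching))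
                   , All.++⁺ (All.map apartᵃ as-free) (All.map apartᵇ bs-free)
                   ∷ AllPairs.++⁺ (AllPairs.filter⁺ left? (proj₂ A.matching))
                                  (AllPairs.filter⁺ right? (proj₂ B.matching))
                                  (All.map (λ p → All.map (Apart⁺ disjoint p) bs-free) as-free)
        ; free     = both fa fb ∷ All.++⁺ (All.map (Both-map (proj₁ ∘ proj₁)) as-free)
                                         (All.map (Both-map (proj₁ ∘ proj₁)) bs-free)
        ; covers   = covered
        }
      where
      module A = IsPairing pairingᵃ
      module B = IsPairing pairingᵇ

      Left Right : Pred Vertex 0ℓ
      Left z = l z < l b
      Right z = r a < r z

      left? : Decidable (Both Left)
      left? = Both? λ z → l z <? l b
      right? : Decidable (Both Right)
      right? = Both? λ z → r a <? r z

      as bs : List Pair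
      as = filter left? ps
      bs = filter right? qs

      FreeLeft FreeRight : Pred Vertex 0ℓ
      FreeLeft z = (Free z × a ≢ z × y ≢ z) × Left z
      FreeRight z = (Free z × b ≢ z × y′ ≢ z) × Right z

      as-free : All (Both FreeLeft) as
      as-free = All.zipWith (Both-zip _,_) (All.filter⁺ left? A.free , All.all-filter left? ps)

      bs-free : All (Both FreeRight) bs
      bs-free = All.zipWith (Both-zip _,_) (All.filter⁺ right? B.free , All.all-filter right? qs)

      disjoint : ∀ {z} → FreeLeft z → ¬ FreeRight z
      disjoint (_ , lz<lb) ((fz , _) , ra<rz) = ℕ.<⇒≱ lz<lb (between _ fz ra<rz)

      a≢b : a ≢ b
      a≢b refl = ℕ.<-irrefl refl ra<rb

      apartᵃ : ∀ {p} → Both FreeLeft p → Apart (a , b) p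
      apartᵃ p = both (Both-map (proj₁ ∘ proj₂ ∘ proj₁) p)
                      -- These pairs avoid `b`, which does not start before itself.
                      (Both-map (λ { (_ , lz<lb) refl → ℕ.<-irrefl refl lz<lb }) p)

      apartᵇ : ∀ {p} → Both FreeRight p → Apart (a , b) p
      apartᵇ p = both (Both-map (λ { (_ , ra<rz) refl → ℕ.<-irrefl refl ra<rz }) p)
                      (Both-map (proj₁ ∘ proj₂ ∘ proj₁) p)

      covered : ∀ w → Done w ⊎ Any (Covers w) ((a , b) ∷ as ++ bs)
      covered w with l b ≤? r w | l w ≤? r a
      -- Such a `w` meets both `a` and `b`.
      ... | yes lb≤rw | yes lw≤ra = inj₂ (here (both
            (Meets⇒N (ℕ.≤-trans la≤lb lb≤rw , lw≤ra))
            (Meets⇒N (lb≤rw , ℕ.≤-trans lw≤ra (ℕ.<⇒≤ ra<rb)))))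
      -- Now `w` ends before `b` starts. It misses `y`, and both ends of a pair covering it start
      -- before `b`, so that pair survives the filter.
      ... | no lb≰rw | _ with A.covers w
      ...   | inj₁ (inj₁ d)  = inj₁ d
      ...   | inj₁ (inj₂ yw) =
              contradiction (ℕ.≤-trans (between y fy ra<ry) (proj₁ (N⇒Meets yw))) lb≰rw
      ...   | inj₂ any = inj₂ (there (Any.++⁺ˡ (Any-filter⁺ left? (Both-map starts-left) any)))
        where
        starts-left : ∀ {v} → N[ v ] w → Left v
        starts-left vw = ℕ.≤-<-trans (proj₁ (N⇒Meets vw)) (ℕ.≰⇒> lb≰rw)
      -- The mirror case: `w` starts after `a` ends, so it misses `y′`.
      covered w | yes _ | no lw≰ra with B.covers w
      ...   | inj₁ (inj₁ d)   = inj₁ d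
      ...   | inj₁ (inj₂ y′w) = contradiction
              (ℕ.≤-trans (proj₂ (N⇒Meets y′w)) (ℕ.≮⇒≥ λ ra<ry′ → ℕ.<⇒≱ ly′<lb (between y′ fy′ ra<ry′)))
              lw≰ra
      ...   | inj₂ any = inj₂ (there (Any.++⁺ʳ as (Any-filter⁺ right? (Both-map ends-right) any)))
        where
        ends-right : ∀ {v} → N[ v ] w → Right v
        ends-right vw = ℕ.<-≤-trans (ℕ.≰⇒> lw≰ra) (proj₂ (N⇒Meets vw))

    -- The right reply to `a` guarantees that some free interval ends after `a`, so `b` exists.
    -- Right endpoints increase strictly, so the sweep stops; the invariant passes to `b` because
    -- what ends after `b` also ends after `a`.
    sweep : ∀ {a} → Acc _>_ (r a) → Free a → (∀ z → Free z → r a < r z → l a ≤ l z) →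
            RightReply a → Pairing Free Done
    sweep {a} (acc rec) fa leftmost right@(y , ra<ry , fy , _)
      with least (λ z → Free? z ×-dec (r a <? r z)) (toℕ ∘ l) (y , fy , ra<ry)
    ... | b , (fb , ra<rb) , b-least with classify fb
    ...   | inj₁ pairing       = pairing
    ...   | inj₂ (inj₁ right′) =
            sweep (rec ra<rb) fb (λ z fz rb<rz → b-least z (fz , ℕ.<-trans ra<rb rb<rz)) right′
    ...   | inj₂ (inj₂ left)   =
            merge fa fb (leftmost b fb ra<rb) ra<rb (λ z fz ra<rz → b-least z (fz , ra<rz)) right left

    replies⇒pairing : ∃ Free → Pairing Free Done
    replies⇒pairing someFree with least Free? (toℕ ∘ l) someFree
    ... | a , fa , a-least with classify fa
    ...   | inj₁ pairing                     = pairing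
    ...   | inj₂ (inj₁ right)                =
            sweep (>-wellFounded (r a)) fa (λ z fz _ → a-least z fz) right
    -- A left reply would start before the leftmost free interval.
    ...   | inj₂ (inj₂ (y , ly<la , fy , _)) = contradiction (a-least y fy) (ℕ.<⇒≱ ly<la)

  -- Induction on the winning strategy

  module _ {k} {l r : Vertex → Fin k} (model : IsModel l r) where

    mutual
      strategy⇒pairing : ∀ {D S} → WinningStrategy G staller D S →
                         Pairing (_∉ D ∪ S) (DominatedBy D)
      strategy⇒pairing (won dominating) = trivialPairing dominating
      strategy⇒pairing {D} {S} (stallerMove someFree respond) =
        replies⇒pairing model (λ v → ¬? (v ∈? D ∪ S))
          (λ x x∉ → strategy⇒reply (respond x x∉)) someFree

      strategy⇒reply : ∀ {D S x} → WinningStrategy G dominator D (S ∪ ⁅ x ⁆) →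
                       Pairing (_∉ D ∪ S) (DominatedBy D) ⊎ ∃ (Reply (_∉ D ∪ S) (DominatedBy D) x)
      -- Dominator may have won without answering `x`; then the empty pairing works.
      strategy⇒reply (won dominating) = inj₁ (trivialPairing dominating)
      strategy⇒reply {D} {S} {x} (dominatorMove y y∉ strategy) =
        let y∉′ , x≢y = free-staller⁻ D S y∉
        in inj₂ (y , y∉′ , x≢y , Pairing-map
             (λ v∉ → let v∉₁ , y≢v = free-dominator⁻ D (S ∪ ⁅ x ⁆) v∉
                         v∉₂ , x≢v = free-staller⁻ D S v∉₁
                     in v∉₂ , x≢v , y≢v)
             (DominatedBy-∪⁅⁆⁻ D) (strategy⇒pairing strategy))

  outcome⇒pairing : IsIntervalGraph G → Outcome𝓓 G → HasPairingDominatingSet G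
  outcome⇒pairing isInterval outcome =
    let _ , _ , model = integer-model isInterval
        ps , pairing  = strategy⇒pairing model (outcome staller)
        open IsPairing pairing
    in ps , record
      { distinct = Matching⇒Unique matching
      -- The empty set dominates nothing, so every vertex is covered by a pair.
      ; covers   = λ w → [ (λ (_ , v∈∅ , _) → contradiction v∈∅ ∉⊥)
                         , Any.map (λ (both uw vw) → uw , vw) ]′ (covers w)
      }

theorem4p6 : (G : Graph) → IsIntervalGraph G → Outcome𝓓 G ⇔ HasPairingDominatingSet G
theorem4p6 G isInterval = mk⇔ (outcome⇒pairing G isInterval) (pairing⇒outcome G)
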